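{- For integers $n\ge 0$, $j\ge0$ let $$c(n,j)=q^{2\binom{n-j}{2}}\frac{(-q^{j};q)_{n-j}}{(-q;q)_{n-j}}\begin{bmatrix} j\\ n-j\end{bmatrix}\quad\text{if } n\ge j,\qquad c(n,j)=0\quad\text{if } n<j.$$ Then for every positive integer $k$ and every nonnegative integer $n$, $$\det\left(c(i+k+1,j+k)\right)_{i,j=0}^{n-1}=\frac{[k]}{[2n+k]}\begin{bmatrix}2n+k\\ n\end{bmatrix}\frac{(-q^{n+1};q)_{k-1}}{(-q;q)_{k-1}}.$$
   Context: $q$ is an indeterminate. $(a;q)_r=(1-a)(1-aq)\cdots(1-aq^{r-1})$ for integers $r\ge0$; $[a]=\frac{1-q^a}{1-q}$; for integers $a\ge0$, $b$, $\begin{bmatrix}a\\ b\end{bmatrix}=\frac{(q;q)_a}{(q;q)_b(q;q)_{a-b}}$ if $0\le b\le a$ and $0$ otherwise. $\binom{a}{2}=a(a-1)/2$. Determinants of $0\times 0$ matrices equal $1$. -}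

module Defs where

open import Data.Nat as ℕ using (ℕ; zero; suc; _∸_; _≤?_)
open import Data.Nat.Combinatorics using (_C_)
open import Data.Integer as ℤ using (ℤ; +_)
open import Data.List using (List; []; _∷_)
open import Data.List.Relation.Unary.All using (All)
open import Data.Fin using (Fin; zero; suc; punchIn)
open import Data.Product using (_×_; _,_)
open import Relation.Binary.PropositionalEquality using (_≡_)
open import Relation.Nullary using (yes; no)

-- Polynomials in q over ℤ: coefficient lists, lowest degree first.

Poly : Set
Poly = List ℤ

infixl 6 _+ₚ_ _-ₚ_
infixl 7 _*ₚ_

_+ₚ_ : Poly → Poly → Poly
[] +ₚ r = r
(a ∷ p) +ₚ [] = a ∷ p
(a ∷ p) +ₚ (b ∷ r) = (a ℤ.+ b) ∷ (p +ₚ r)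

scale : ℤ → Poly → Poly
scale c [] = []
scale c (a ∷ p) = (c ℤ.* a) ∷ scale c p

negₚ : Poly → Poly
negₚ = scale (ℤ.- (+ 1))

_-ₚ_ : Poly → Poly → Poly
p -ₚ r = p +ₚ negₚ r

_*ₚ_ : Poly → Poly → Poly
[] *ₚ r = []
(a ∷ p) *ₚ r = scale a r +ₚ (+ 0 ∷ (p *ₚ r))

constₚ : ℤ → Poly
constₚ c = c ∷ []

oneₚ : Poly
oneₚ = constₚ (+ 1)

qpow : ℕ → Poly
qpow zero = oneₚ
qpow (suc m) = + 0 ∷ qpow m

_≈ₚ_ : Poly → Poly → Set
p ≈ₚ r = All (_≡ + 0) (p -ₚ r)

poch : Poly → ℕ → Poly
poch a zero = oneₚ
poch a (suc r) = poch a r *ₚ (oneₚ -ₚ (a *ₚ qpow r))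

RatFun : Set
RatFun = Poly × Poly

infixl 6 _+ᵣ_
infixl 7 _*ᵣ_ _/ᵣ_
infix 4 _≃_

_≃_ : RatFun → RatFun → Set
(a , b) ≃ (c , d) = (a *ₚ d) ≈ₚ (c *ₚ b)

_+ᵣ_ : RatFun → RatFun → RatFun
(a , b) +ᵣ (c , d) = (a *ₚ d +ₚ c *ₚ b) , (b *ₚ d)

_*ᵣ_ : RatFun → RatFun → RatFun
(a , b) *ᵣ (c , d) = (a *ₚ c) , (b *ₚ d)

_/ᵣ_ : RatFun → RatFun → RatFun
(a , b) /ᵣ (c , d) = (a *ₚ d) , (b *ₚ c)

negᵣ : RatFun → RatFun
negᵣ (a , b) = negₚ a , b

fromPoly : Poly → RatFun
fromPoly p = p , oneₚ

0ᵣ 1ᵣ : RatFun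
0ᵣ = fromPoly []
1ᵣ = fromPoly oneₚ

qint : ℕ → RatFun
qint a = (oneₚ -ₚ qpow a) , (oneₚ -ₚ qpow 1)

qfac : ℕ → Poly
qfac a = poch (qpow 1) a

qbinom : ℕ → ℕ → RatFun
qbinom a b with b ≤? a
... | yes _ = qfac a , (qfac b *ₚ qfac (a ∸ b))
... | no _  = 0ᵣ

negPoch : ℕ → ℕ → Poly
negPoch m r = poch (negₚ (qpow m)) r

det : (n : ℕ) → (Fin n → Fin n → RatFun) → RatFun
det zero M = 1ᵣ
det (suc n) M = go (suc n) (λ j → j) 1ᵣ
  where
  minor : Fin (suc n) → Fin n → Fin n → RatFun
  minor j i l = M (suc i) (punchIn j l)
  go : (m : ℕ) → (Fin m → Fin (suc n)) → RatFun → RatFun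
  go zero e s = 0ᵣ
  go (suc m) e s =
    (s *ᵣ M zero (e zero) *ᵣ det n (minor (e zero)))
      +ᵣ go m (λ t → e (suc t)) (negᵣ s)

c : ℕ → ℕ → RatFun
c n j with j ≤? n
... | yes _ = fromPoly (qpow (2 ℕ.* ((n ∸ j) C 2)))
              *ᵣ (negPoch j (n ∸ j) , negPoch 1 (n ∸ j))
              *ᵣ qbinom j (n ∸ j)
... | no _  = 0ᵣ

rhs : ℕ → ℕ → RatFun
rhs k n = (qint k /ᵣ qint (2 ℕ.* n ℕ.+ k))
          *ᵣ qbinom (2 ℕ.* n ℕ.+ k) n
          *ᵣ (negPoch (n ℕ.+ 1) (k ∸ 1) , negPoch 1 (k ∸ 1))

{-# OPTIONS --safe #-}
module Submission where

-- The matrix is Hessenberg: its superdiagonal is 1 and everything above that is 0.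
-- Expanding along the first row therefore leaves two minors of the same kind,
-- provided the first column is allowed to lag behind the others: let W(k,s,m) be
-- the m×m determinant with first column c(k+s+i,k) and remaining columns
-- c(k+s+i,k+s+j).  Then W(k,s,m+1) = c(k+s,k) W(k+s,1,m) - W(k,s+1,m) for m ≥ 1,
-- and induction on m proves, with f(r) = (q;q)_r, g(r) = (-q;q)_r, n = s+m-1,
--   W(k,s,m) = q^(s(s-1)) f(2n+k-s) f(k) g(n+k-1)
--     / (g(k-1) f(n+k) (1-q^(2n)) f(s-1) g(s-1) f(m-1) g(m-1) f(k-s))
-- for s ≤ k, and W(k,s,m) = 0 for s > k.  The theorem is the case s = 1.
-- This closed form comes from telescoping the alternating sum that the recursion
-- unrolls to.

open import Defs
open import Algebra using (CommutativeRing)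
import Algebra.Properties.CommutativeSemigroup as CommutativeSemigroupProperties
import Algebra.Solver.Ring
open import Algebra.Solver.Ring.AlmostCommutativeRing using (fromCommutativeRing; _-Raw-AlmostCommutative⟶_)
open import Data.Nat as ℕ using (ℕ; zero; suc; _≤_; _<_; _+_; _≤?_; z≤n; s≤s)
open import Data.Nat.Combinatorics using (_C_; nC1≡n; nCk+nC[k+1]≡[n+1]C[k+1])
import Data.Nat.Properties as ℕ
open import Data.Nat.Solver using (module +-*-Solver)
open import Data.Fin using (Fin; zero; suc; toℕ; punchIn)
open import Data.Integer as ℤ using (ℤ; +_)
import Data.Integer.Properties as ℤ
open import Data.List using ([]; _∷_)
open import Data.List.Relation.Unary.All using (All; []; _∷_)
open import Data.Maybe using (Maybe; just; nothing)
open import Data.Product using (_,_; proj₁; proj₂)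
open import Relation.Binary.PropositionalEquality using (_≡_; refl; sym; trans; cong; cong₂; subst)
open import Relation.Nullary using (yes; no; contradiction)

private module N = +-*-Solver

-- Polynomials as a commutative ring

coeff : Poly → ℕ → ℤ
coeff []      _       = + 0
coeff (a ∷ p) zero    = a
coeff (a ∷ p) (suc i) = coeff p i

-- Lists that differ in trailing zeros denote the same polynomial, so they are compared coefficient
-- by coefficient. The record wrapper keeps `p` and `r` visible to unification.
infix 4 _≋_
record _≋_ (p r : Poly) : Set where
  constructor coeffwise
  field at : ∀ i → coeff p i ≡ coeff r i
open _≋_

≋-refl : ∀ {p} → p ≋ p
≋-refl = coeffwise λ _ → refl

≋-sym : ∀ {p r} → p ≋ r → r ≋ p
≋-sym h = coeffwise λ i → sym (at h i)

≋-trans : ∀ {p r t} → p ≋ r → r ≋ t → p ≋ t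
≋-trans h k = coeffwise λ i → trans (at h i) (at k i)

≡⇒≋ : ∀ {p r} → p ≡ r → p ≋ r
≡⇒≋ refl = ≋-refl

coeff-+ : ∀ p r i → coeff (p +ₚ r) i ≡ coeff p i ℤ.+ coeff r i
coeff-+ []      r       i       = sym (ℤ.+-identityˡ _)
coeff-+ (a ∷ p) []      i       = sym (ℤ.+-identityʳ _)
coeff-+ (a ∷ p) (b ∷ r) zero    = refl
coeff-+ (a ∷ p) (b ∷ r) (suc i) = coeff-+ p r i

coeff-scale : ∀ x p i → coeff (scale x p) i ≡ x ℤ.* coeff p i
coeff-scale x []      i       = sym (ℤ.*-zeroʳ x)
coeff-scale x (a ∷ p) zero    = refl
coeff-scale x (a ∷ p) (suc i) = coeff-scale x p i

coeff-neg : ∀ p i → coeff (negₚ p) i ≡ ℤ.- coeff p i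
coeff-neg p i = trans (coeff-scale (ℤ.- (+ 1)) p i) (ℤ.-1*i≡-i _)

+ₚ-cong : ∀ {p p′ r r′} → p ≋ p′ → r ≋ r′ → p +ₚ r ≋ p′ +ₚ r′
+ₚ-cong {p} {p′} {r} {r′} h k = coeffwise λ i →
  trans (coeff-+ p r i) (trans (cong₂ ℤ._+_ (at h i) (at k i)) (sym (coeff-+ p′ r′ i)))

scale-cong : ∀ x {p r} → p ≋ r → scale x p ≋ scale x r
scale-cong x {p} {r} h = coeffwise λ i →
  trans (coeff-scale x p i) (trans (cong (x ℤ.*_) (at h i)) (sym (coeff-scale x r i)))

∷-cong : ∀ {a b p r} → a ≡ b → p ≋ r → a ∷ p ≋ b ∷ r
∷-cong e h = coeffwise λ { zero → e ; (suc i) → at h i }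

∷-zero : ∀ {p} → p ≋ [] → + 0 ∷ p ≋ []
∷-zero h = coeffwise λ { zero → refl ; (suc i) → at h i }

tail-zero : ∀ {a p} → a ∷ p ≋ [] → p ≋ []
tail-zero h = coeffwise λ i → at h (suc i)

+ₚ-assoc : ∀ p r t → (p +ₚ r) +ₚ t ≋ p +ₚ (r +ₚ t)
+ₚ-assoc p r t = coeffwise λ i →
  trans (coeff-+ (p +ₚ r) t i)
    (trans (cong (ℤ._+ coeff t i) (coeff-+ p r i))
      (trans (ℤ.+-assoc (coeff p i) _ _)
        (sym (trans (coeff-+ p (r +ₚ t) i) (cong₂ ℤ._+_ (refl {x = coeff p i}) (coeff-+ r t i))))))

+ₚ-comm : ∀ p r → p +ₚ r ≋ r +ₚ p
+ₚ-comm p r = coeffwise λ i →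
  trans (coeff-+ p r i) (trans (ℤ.+-comm (coeff p i) _) (sym (coeff-+ r p i)))

+ₚ-identityʳ : ∀ p → p +ₚ [] ≋ p
+ₚ-identityʳ p = coeffwise λ i → trans (coeff-+ p [] i) (ℤ.+-identityʳ _)

+ₚ-inverseʳ : ∀ p → p +ₚ negₚ p ≋ []
+ₚ-inverseʳ p = coeffwise λ i →
  trans (coeff-+ p (negₚ p) i)
    (trans (cong₂ ℤ._+_ (refl {x = coeff p i}) (coeff-neg p i)) (ℤ.+-inverseʳ (coeff p i)))

+ₚ-interchange : ∀ p r t u → (p +ₚ r) +ₚ (t +ₚ u) ≋ (p +ₚ t) +ₚ (r +ₚ u)
+ₚ-interchange p r t u = coeffwise λ i →
  trans (expand p r t u i)
    (trans (interchange (coeff p i) (coeff r i) (coeff t i) (coeff u i))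
      (sym (expand p t r u i)))
  where
  open CommutativeSemigroupProperties ℤ.+-commutativeSemigroup using (interchange)
  expand : ∀ p r t u i → coeff ((p +ₚ r) +ₚ (t +ₚ u)) i ≡
           (coeff p i ℤ.+ coeff r i) ℤ.+ (coeff t i ℤ.+ coeff u i)
  expand p r t u i = trans (coeff-+ (p +ₚ r) (t +ₚ u) i) (cong₂ ℤ._+_ (coeff-+ p r i) (coeff-+ t u i))

scale-+ : ∀ x p r → scale x (p +ₚ r) ≋ scale x p +ₚ scale x r
scale-+ x p r = coeffwise λ i →
  trans (coeff-scale x (p +ₚ r) i)
    (trans (cong (x ℤ.*_) (coeff-+ p r i))
      (trans (ℤ.*-distribˡ-+ x (coeff p i) _)
        (sym (trans (coeff-+ (scale x p) (scale x r) i)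
               (cong₂ ℤ._+_ (coeff-scale x p i) (coeff-scale x r i))))))

scale-scale : ∀ x y p → scale x (scale y p) ≋ scale (x ℤ.* y) p
scale-scale x y p = coeffwise λ i →
  trans (coeff-scale x (scale y p) i)
    (trans (cong (x ℤ.*_) (coeff-scale y p i))
      (trans (sym (ℤ.*-assoc x y (coeff p i))) (sym (coeff-scale (x ℤ.* y) p i))))

scale-1 : ∀ p → scale (+ 1) p ≋ p
scale-1 p = coeffwise λ i → trans (coeff-scale (+ 1) p i) (ℤ.*-identityˡ _)

scale-0 : ∀ p → scale (+ 0) p ≋ []
scale-0 p = coeffwise λ i → trans (coeff-scale (+ 0) p i) (ℤ.*-zeroˡ (coeff p i))

*ₚ-congˡ : ∀ p {r r′} → r ≋ r′ → p *ₚ r ≋ p *ₚ r′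
*ₚ-congˡ []      h = ≋-refl
*ₚ-congˡ (a ∷ p) h = +ₚ-cong (scale-cong a h) (∷-cong refl (*ₚ-congˡ p h))

*ₚ-zeroʳ : ∀ p → p *ₚ [] ≋ []
*ₚ-zeroʳ []      = ≋-refl
*ₚ-zeroʳ (a ∷ p) = ∷-zero (*ₚ-zeroʳ p)

-- The defining recursion of `*ₚ` mirrored to the second factor, as the induction for commutativity
-- requires.
*ₚ-∷ʳ : ∀ p b r → p *ₚ (b ∷ r) ≋ scale b p +ₚ (+ 0 ∷ (p *ₚ r))
*ₚ-∷ʳ []      b r = ≋-sym (∷-zero ≋-refl)
*ₚ-∷ʳ (a ∷ p) b r = ∷-cong (cong (ℤ._+ + 0) (ℤ.*-comm a b))
  (≋-trans (+ₚ-cong ≋-refl (*ₚ-∷ʳ p b r))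
    (≋-trans (≋-sym (+ₚ-assoc (scale a r) _ _))
      (≋-trans (+ₚ-cong (+ₚ-comm (scale a r) (scale b p)) ≋-refl)
        (+ₚ-assoc (scale b p) (scale a r) _))))

*ₚ-comm : ∀ p r → p *ₚ r ≋ r *ₚ p
*ₚ-comm []      r = ≋-sym (*ₚ-zeroʳ r)
*ₚ-comm (a ∷ p) r = ≋-sym (≋-trans (*ₚ-∷ʳ r a p)
  (+ₚ-cong ≋-refl (∷-cong refl (≋-sym (*ₚ-comm p r)))))

-- `*ₚ` recurses on its first factor, and equal polynomials may be lists of different lengths.
-- Congruence there is borrowed from the second factor by commutativity.
*ₚ-cong : ∀ {p p′ r r′} → p ≋ p′ → r ≋ r′ → p *ₚ r ≋ p′ *ₚ r′
*ₚ-cong {p} {p′} {r} {r′} h k =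
  ≋-trans (*ₚ-congˡ p k)
    (≋-trans (*ₚ-comm p r′) (≋-trans (*ₚ-congˡ r′ h) (*ₚ-comm r′ p′)))

*ₚ-distribˡ : ∀ p r t → p *ₚ (r +ₚ t) ≋ p *ₚ r +ₚ p *ₚ t
*ₚ-distribˡ []      r t = ≋-refl
*ₚ-distribˡ (a ∷ p) r t =
  ≋-trans (+ₚ-cong (scale-+ a r t) (∷-cong refl (*ₚ-distribˡ p r t)))
    (+ₚ-interchange (scale a r) (scale a t) (+ 0 ∷ (p *ₚ r)) (+ 0 ∷ (p *ₚ t)))

*ₚ-distribʳ : ∀ p r t → (r +ₚ t) *ₚ p ≋ r *ₚ p +ₚ t *ₚ p
*ₚ-distribʳ p r t = ≋-trans (*ₚ-comm (r +ₚ t) p)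
  (≋-trans (*ₚ-distribˡ p r t) (+ₚ-cong (*ₚ-comm p r) (*ₚ-comm p t)))

scale-* : ∀ x p r → scale x p *ₚ r ≋ scale x (p *ₚ r)
scale-* x []      r = ≋-refl
scale-* x (a ∷ p) r =
  ≋-trans (+ₚ-cong (≋-sym (scale-scale x a r)) (∷-cong (sym (ℤ.*-zeroʳ x)) (scale-* x p r)))
    (≋-sym (scale-+ x (scale a r) (+ 0 ∷ (p *ₚ r))))

*ₚ-assoc : ∀ p r t → (p *ₚ r) *ₚ t ≋ p *ₚ (r *ₚ t)
*ₚ-assoc []      r t = ≋-refl
*ₚ-assoc (a ∷ p) r t =
  ≋-trans (*ₚ-distribʳ t (scale a r) (+ 0 ∷ (p *ₚ r)))
    (+ₚ-cong (scale-* a r t)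
      (≋-trans (+ₚ-cong (scale-0 t) ≋-refl) (∷-cong refl (*ₚ-assoc p r t))))

*ₚ-identityˡ : ∀ p → oneₚ *ₚ p ≋ p
*ₚ-identityˡ p = ≋-trans (+ₚ-cong (scale-1 p) (∷-zero ≋-refl)) (+ₚ-identityʳ p)

polyRing : CommutativeRing _ _
polyRing = record
  { Carrier = Poly ; _≈_ = _≋_ ; _+_ = _+ₚ_ ; _*_ = _*ₚ_ ; -_ = negₚ ; 0# = [] ; 1# = oneₚ
  ; isCommutativeRing = record
    { isRing = record
      { +-isAbelianGroup = record
        { isGroup = record
          { isMonoid = record
            { isSemigroup = record
              { isMagma = record
                { isEquivalence = record { refl = ≋-refl ; sym = ≋-sym ; trans = ≋-trans }
                ; ∙-cong = +ₚ-cong }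
              ; assoc = +ₚ-assoc }
            ; identity = (λ _ → ≋-refl) , +ₚ-identityʳ }
          ; inverse = (λ p → ≋-trans (+ₚ-comm (negₚ p) p) (+ₚ-inverseʳ p)) , +ₚ-inverseʳ
          ; ⁻¹-cong = scale-cong (ℤ.- (+ 1)) }
        ; comm = +ₚ-comm }
      ; *-cong = *ₚ-cong
      ; *-assoc = *ₚ-assoc
      ; *-identity = *ₚ-identityˡ , λ p → ≋-trans (*ₚ-comm p oneₚ) (*ₚ-identityˡ p)
      ; distrib = *ₚ-distribˡ , *ₚ-distribʳ }
    ; *-comm = *ₚ-comm } }

-- Integers, embedded as constants, serve as the solver's coefficients, so like terms are collected
-- by integer arithmetic.
constₚ-hom : ℤ.+-*-rawRing -Raw-AlmostCommutative⟶ fromCommutativeRing polyRing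
constₚ-hom = record
  { ⟦_⟧    = constₚ
  ; +-homo = λ _ _ → ≋-refl
  ; *-homo = λ x y → ∷-cong (sym (ℤ.+-identityʳ _)) ≋-refl
  ; -‿homo = λ x → ∷-cong (sym (ℤ.-1*i≡-i x)) ≋-refl
  ; 0-homo = ∷-zero ≋-refl
  ; 1-homo = ≋-refl
  }

constₚ-≟ : ∀ x y → Maybe (constₚ x ≋ constₚ y)
constₚ-≟ x y with x ℤ.≟ y
... | yes refl = just ≋-refl
... | no  _    = nothing

module PolySolver = Algebra.Solver.Ring ℤ.+-*-rawRing (fromCommutativeRing polyRing) constₚ-hom constₚ-≟

-- Fractions whose denominator has constant coefficient 1

≋⇒≈ₚ : ∀ p r → p ≋ r → p ≈ₚ r
≋⇒≈ₚ p r h = zeros (p -ₚ r) (≋-trans (+ₚ-cong h ≋-refl) (+ₚ-inverseʳ r))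
  where
  zeros : ∀ p → p ≋ [] → All (_≡ + 0) p
  zeros []      h = []
  zeros (a ∷ p) h = at h 0 ∷ zeros p (tail-zero h)

*ₚ-zero-left : ∀ {p} r → p ≋ [] → p *ₚ r ≋ []
*ₚ-zero-left r h = *ₚ-cong h (≋-refl {r})

*ₚ-zero-right : ∀ p {r} → r ≋ [] → p *ₚ r ≋ []
*ₚ-zero-right p h = ≋-trans (*ₚ-congˡ p h) (*ₚ-zeroʳ p)

-- Every denominator that has to be cancelled is a product of factors 1 ± q^m with m ≥ 1. Constant
-- coefficient 1 is preserved by products and suffices for cancellation.
UnitConst : Poly → Set
UnitConst p = coeff p 0 ≡ + 1

coeff₀-* : ∀ p r → coeff (p *ₚ r) 0 ≡ coeff p 0 ℤ.* coeff r 0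
coeff₀-* []      r = sym (ℤ.*-zeroˡ (coeff r 0))
coeff₀-* (a ∷ p) r = trans (coeff-+ (scale a r) (+ 0 ∷ (p *ₚ r)) 0)
  (trans (ℤ.+-identityʳ _) (coeff-scale a r 0))

UnitConst-* : ∀ p r → UnitConst p → UnitConst r → UnitConst (p *ₚ r)
UnitConst-* p r h k = trans (coeff₀-* p r) (cong₂ ℤ._*_ h k)

-- Induction from the lowest coefficient: `p *ₚ d` has the same constant coefficient as `p`, so this
-- is zero, and what remains is the tail of `p` times `d`, shifted by one degree.
unitConst-noZeroDivisor : ∀ p d → UnitConst d → p *ₚ d ≋ [] → p ≋ []
unitConst-noZeroDivisor []      d u h = ≋-refl
unitConst-noZeroDivisor (a ∷ p) d u h = ≋-trans (∷-cong a≡0 (unitConst-noZeroDivisor p d u pd)) (∷-zero ≋-refl)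
  where
  a≡0 : a ≡ + 0
  a≡0 = trans (sym (ℤ.*-identityʳ a))
    (trans (cong (a ℤ.*_) (sym u)) (trans (sym (coeff₀-* (a ∷ p) d)) (at h 0)))
  pd : p *ₚ d ≋ []
  pd = tail-zero (≋-trans (≋-sym (≋-trans (*ₚ-cong {a ∷ p} {+ 0 ∷ p} (∷-cong a≡0 ≋-refl) ≋-refl)
         (+ₚ-cong (scale-0 d) ≋-refl))) h)

open PolySolver

*ₚ-cancelʳ : ∀ p r d → UnitConst d → p *ₚ d ≋ r *ₚ d → p ≋ r
*ₚ-cancelʳ p r d u h = ≋-trans
  (solve 2 (λ x y → x := y :+ (x :- y)) ≋-refl p r)
  (≋-trans (+ₚ-cong ≋-refl (unitConst-noZeroDivisor (p -ₚ r) d u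
     (≋-trans (solve 3 (λ x y z → (x :- y) :* z := x :* z :- y :* z) ≋-refl p r d)
       (≋-trans (+ₚ-cong h ≋-refl) (+ₚ-inverseʳ (r *ₚ d))))))
    (+ₚ-identityʳ r))

infix 4 _∼_
record _∼_ (x y : RatFun) : Set where
  constructor cross
  field uncross : proj₁ x *ₚ proj₂ y ≋ proj₁ y *ₚ proj₂ x
open _∼_

∼⇒≃ : ∀ {x y} → x ∼ y → x ≃ y
∼⇒≃ {a , b} {c , d} (cross h) = ≋⇒≈ₚ (a *ₚ d) (c *ₚ b) h

∼-refl : ∀ {x} → x ∼ x
∼-refl = cross ≋-refl

∼-reflexive : ∀ {x y} → x ≡ y → x ∼ y
∼-reflexive refl = ∼-refl

∼-sym : ∀ {x y} → x ∼ y → y ∼ x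
∼-sym (cross h) = cross (≋-sym h)

-- Chaining two cross-multiplied equations leaves the middle denominator as a common factor, hence
-- the condition on it. The outer denominators are arbitrary, so `x` may be a determinant whose
-- denominator is never computed.
∼-trans : ∀ {x} y {z} → UnitConst (proj₂ y) → x ∼ y → y ∼ z → x ∼ z
∼-trans {a , b} (c , d) {e , f} u (cross h) (cross k) = cross (*ₚ-cancelʳ _ _ d u
  (≋-trans (solve 3 (λ a f d → a :* f :* d := a :* d :* f) ≋-refl a f d)
  (≋-trans (*ₚ-cong h ≋-refl)
  (≋-trans (solve 3 (λ c b f → c :* b :* f := c :* f :* b) ≋-refl c b f)
  (≋-trans (*ₚ-cong k ≋-refl)
    (solve 3 (λ e d b → e :* d :* b := e :* b :* d) ≋-refl e d b))))))

∼-respˡ : ∀ {p p′ b y} → p ≋ p′ → (p′ , b) ∼ y → (p , b) ∼ y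
∼-respˡ h (cross k) = cross (≋-trans (*ₚ-cong h ≋-refl) k)

*ᵣ-cong : ∀ {x x′ y y′} → x ∼ x′ → y ∼ y′ → x *ᵣ y ∼ x′ *ᵣ y′
*ᵣ-cong {a , b} {a′ , b′} {c , d} {c′ , d′} (cross h) (cross k) = cross
  (≋-trans (solve 4 (λ a c b′ d′ → (a :* c) :* (b′ :* d′) := (a :* b′) :* (c :* d′)) ≋-refl a c b′ d′)
  (≋-trans (*ₚ-cong h k)
    (solve 4 (λ a′ c′ b d → (a′ :* b) :* (c′ :* d) := (a′ :* c′) :* (b :* d)) ≋-refl a′ c′ b d)))

+ᵣ-cong : ∀ {x x′ y y′} → x ∼ x′ → y ∼ y′ → x +ᵣ y ∼ x′ +ᵣ y′
+ᵣ-cong {a , b} {a′ , b′} {c , d} {c′ , d′} (cross h) (cross k) = cross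
  (≋-trans (solve 6 (λ a c b d b′ d′ → (a :* d :+ c :* b) :* (b′ :* d′) :=
      (a :* b′) :* (d :* d′) :+ (c :* d′) :* (b :* b′)) ≋-refl a c b d b′ d′)
  (≋-trans (+ₚ-cong (*ₚ-cong h ≋-refl) (*ₚ-cong k ≋-refl))
    (solve 6 (λ a c b d b′ d′ → (a :* b) :* (d :* d′) :+ (c :* d) :* (b :* b′) :=
      (a :* d′ :+ c :* b′) :* (b :* d)) ≋-refl a′ c′ b d b′ d′)))

negᵣ-cong : ∀ {x y} → x ∼ y → negᵣ x ∼ negᵣ y
negᵣ-cong {a , b} {c , d} (cross h) = cross
  (≋-trans (solve 2 (λ a d → (:- a) :* d := :- (a :* d)) ≋-refl a d)
  (≋-trans (scale-cong _ h) (solve 2 (λ a d → :- (a :* d) := (:- a) :* d) ≋-refl c b)))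

∼0⇒ : ∀ {x} → x ∼ 0ᵣ → proj₁ x ≋ []
∼0⇒ {a , b} (cross h) = ≋-trans (solve 1 (λ a → a := a :* con (+ 1)) ≋-refl a) h

⇒∼0 : ∀ {x} → proj₁ x ≋ [] → x ∼ 0ᵣ
⇒∼0 h = cross (*ₚ-zero-left oneₚ h)

-- Expansion along a first row with two nonzero entries

Matrix : ℕ → Set
Matrix n = Fin n → Fin n → RatFun

minor : ∀ {n} → Fin (suc n) → Matrix (suc n) → Matrix n
minor j M i l = M (suc i) (punchIn j l)

-- The first two summands of the expansion, spelled exactly as `det` builds them, signs included, so
-- that `det-expand` can hold by computation.
head₁ head₂ : ∀ {n} → Matrix (suc (suc n)) → RatFun
head₁ M = 1ᵣ *ᵣ M zero zero *ᵣ det _ (minor zero M)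
head₂ M = negᵣ 1ᵣ *ᵣ M zero (suc zero) *ᵣ det _ (minor (suc zero) M)

-- num and den stand for the numerator and denominator of the function local to
-- det, which has no name outside Defs.  Both are metavariables, solved by the
-- refl of det-expand once the with-abstractions turn their arguments into
-- distinct variables.  The unifier does not see through *ₚ, hence num keeps the
-- surrounding factors: it is (a * den + numerator * b) * b′.
mutual
  num : (n : ℕ) → Matrix (suc n) → (m : ℕ) → (Fin m → Fin (suc n)) → RatFun → Poly → Poly → Poly → Poly
  num = _
  den : (n : ℕ) → Matrix (suc n) → (m : ℕ) → (Fin m → Fin (suc n)) → RatFun → Poly
  den = _

  det-expand : ∀ n (M : Matrix (suc (suc n))) →
    let D = den (suc n) M n (λ t → suc (suc t)) (negᵣ (negᵣ 1ᵣ)) in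
    det (suc (suc n)) M ≡
    ( proj₁ (head₁ M) *ₚ (proj₂ (head₂ M) *ₚ D)
        +ₚ num (suc n) M n (λ t → suc (suc t)) (negᵣ (negᵣ 1ᵣ)) (proj₁ (head₂ M)) (proj₂ (head₂ M)) (proj₂ (head₁ M))
    , proj₂ (head₁ M) *ₚ (proj₂ (head₂ M) *ₚ D))
  det-expand n M with proj₁ (head₁ M) | proj₂ (head₁ M) | proj₁ (head₂ M) | proj₂ (head₂ M)
  ... | a₁ | b₁ | a₂ | b₂ with suc n | M | (λ (t : Fin n) → Fin.suc (Fin.suc t)) | negᵣ (negᵣ 1ᵣ)
  ... | N | M' | e | s = refl

-- A zero summand still multiplies the denominator of the running sum. The tail therefore vanishes
-- in its numerator only, and `den` survives.
num-vanishing : ∀ n M m e s → (∀ t → M zero (e t) ∼ 0ᵣ) → ∀ a b b′ →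
  num n M m e s a b b′ ≋ a *ₚ den n M m e s *ₚ b′
num-vanishing n M zero    e s h a b b′ = *ₚ-cong (+ₚ-identityʳ (a *ₚ oneₚ)) (≋-refl {b′})
num-vanishing n M (suc m) e s h a b b′ = *ₚ-cong {r = b′}
  (≋-trans (+ₚ-cong {a *ₚ d} ≋-refl
      -- The numerator of the tail times `b` is itself an instance of `num`, with the first summand
      -- `x` of the tail supplying its numerator and denominator.
      (≋-trans (num-vanishing n M m (λ t → e (suc t)) (negᵣ s) (λ t → h (suc t)) (proj₁ x) (proj₂ x) b)
        (*ₚ-zero-left b (*ₚ-zero-left (den n M m (λ t → e (suc t)) (negᵣ s)) x≋0))))
    (+ₚ-identityʳ (a *ₚ d))) ≋-refl
  where
  x : RatFun
  x = s *ᵣ M zero (e zero) *ᵣ det n (minor (e zero) M)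
  d : Poly
  d = den n M (suc m) e s
  x≋0 : proj₁ x ≋ []
  x≋0 = *ₚ-zero-left (proj₁ (det n (minor (e zero) M))) (*ₚ-zero-right (proj₁ s) (∼0⇒ (h zero)))

module _ (n : ℕ) (M : Matrix (suc (suc n))) (vanishing : ∀ t → M zero (suc (suc t)) ∼ 0ᵣ) where

  private
    D : Poly
    D = den (suc n) M n (λ t → suc (suc t)) (negᵣ (negᵣ 1ᵣ))

  det-numerator : proj₁ (det (suc (suc n)) M) ≋
    proj₁ (head₁ M) *ₚ (proj₂ (head₂ M) *ₚ D) +ₚ proj₁ (head₂ M) *ₚ D *ₚ proj₂ (head₁ M)
  det-numerator = ≋-trans (≡⇒≋ (cong proj₁ (det-expand n M)))
    (+ₚ-cong ≋-refl (num-vanishing (suc n) M n (λ t → suc (suc t)) (negᵣ (negᵣ 1ᵣ)) vanishing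
      (proj₁ (head₂ M)) (proj₂ (head₂ M)) (proj₂ (head₁ M))))

  -- The leftover `D` is a factor of both numerator and denominator, so the cross-multiplied claim
  -- is the two-term identity `heads` multiplied by `D`.
  det-two-terms : ∀ {x h w} → M zero zero ∼ x → M zero (suc zero) ∼ 1ᵣ →
    det (suc n) (minor zero M) ∼ h → det (suc n) (minor (suc zero) M) ∼ w →
    det (suc (suc n)) M ∼ x *ᵣ h +ᵣ negᵣ w
  det-two-terms {x₁ , x₂} {h₁ , h₂} {w₁ , w₂} M₀₀ M₀₁ D₀ D₁ = ∼-respˡ det-numerator
    (cross (≋-trans
      (solve 6 (λ a b c d D r → (a :* (d :* D) :+ c :* D :* b) :* r :=
        (a :* d :+ c :* b) :* r :* D) ≋-refl
        (proj₁ (head₁ M)) (proj₂ (head₁ M)) (proj₁ (head₂ M)) (proj₂ (head₂ M)) D _)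
      (≋-trans (*ₚ-cong (uncross heads) ≋-refl)
        (solve 4 (λ a b c D → a :* (b :* c) :* D := a :* (b :* (c :* D))) ≋-refl
          (proj₁ ((x₁ , x₂) *ᵣ (h₁ , h₂) +ᵣ negᵣ (w₁ , w₂))) (proj₂ (head₁ M)) (proj₂ (head₂ M)) D))))
    where
    1*_ : ∀ {x y} → x ∼ y → 1ᵣ *ᵣ x ∼ y
    1*_ {a , b} {c , d} (cross h) = cross (≋-trans (*ₚ-cong (*ₚ-identityˡ a) ≋-refl)
      (≋-trans h (*ₚ-congˡ c (≋-sym (*ₚ-identityˡ b)))))
    -1*_*_ : ∀ {x y z} → x ∼ 1ᵣ → y ∼ z → negᵣ 1ᵣ *ᵣ x *ᵣ y ∼ negᵣ z
    -1*_*_ {a , b} {c , d} {e , f} (cross h) (cross k) = cross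
      (≋-trans (solve 3 (λ a c f → con (ℤ.- (+ 1)) :* a :* c :* f := :- ((a :* con (+ 1)) :* (c :* f))) ≋-refl a c f)
      (≋-trans (scale-cong _ (*ₚ-cong h k))
        (solve 3 (λ b e d → :- ((con (+ 1) :* b) :* (e :* d)) := (:- e) :* (con (+ 1) :* b :* d)) ≋-refl b e d)))
    heads : head₁ M +ᵣ head₂ M ∼ (x₁ , x₂) *ᵣ (h₁ , h₂) +ᵣ negᵣ (w₁ , w₂)
    heads = +ᵣ-cong (*ᵣ-cong (1* M₀₀) D₀) (-1* M₀₁ * D₁)

  det-zero-column : M zero zero ∼ 0ᵣ → det (suc n) (minor (suc zero) M) ∼ 0ᵣ → det (suc (suc n)) M ∼ 0ᵣ
  det-zero-column M₀₀ D₁ = ⇒∼0 (≋-trans det-numerator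
    (+ₚ-cong (*ₚ-zero-left _ (*ₚ-zero-left (proj₁ (det (suc n) (minor zero M))) (*ₚ-zero-right oneₚ (∼0⇒ M₀₀))))
      (*ₚ-zero-left (proj₂ (head₁ M)) (*ₚ-zero-left D (*ₚ-zero-right (proj₁ (negᵣ 1ᵣ *ᵣ M zero (suc zero))) (∼0⇒ D₁))))))

det₁ : ∀ (M : Matrix 1) {y} → M zero zero ∼ y → det 1 M ∼ y
det₁ M {c , d} (cross h) = ∼-respˡ
  (≋-trans (+ₚ-identityʳ (oneₚ *ₚ a *ₚ oneₚ *ₚ oneₚ))
    (solve 1 (λ a → con (+ 1) :* a :* con (+ 1) :* con (+ 1) := a) ≋-refl a))
  (cross (≋-trans h (solve 2 (λ b c → c :* b := c :* (con (+ 1) :* b :* con (+ 1) :* con (+ 1))) ≋-refl b c)))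
  where
  a b : Poly
  a = proj₁ (M zero zero)
  b = proj₂ (M zero zero)

-- The entries c and the Hessenberg recursion

qpow-+ : ∀ m n → qpow (m + n) ≋ qpow m *ₚ qpow n
qpow-+ zero    n = ≋-sym (*ₚ-identityˡ (qpow n))
qpow-+ (suc m) n = ≋-trans (∷-cong refl (qpow-+ m n)) (≋-sym (+ₚ-cong (scale-0 (qpow n)) ≋-refl))

-- φ m and ψ m are the last factors of qfac (suc m) and negPoch 1 (suc m), which
-- unfold to them definitionally; φ⁻ b = 1 - q^b, so φ⁻ is φ shifted by one.
φ ψ κ φ⁻ : ℕ → Poly
φ m = oneₚ -ₚ (qpow 1 *ₚ qpow m)
ψ m = oneₚ -ₚ (negₚ (qpow 1) *ₚ qpow m)
κ m = φ m *ₚ ψ m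
φ⁻ zero    = []
φ⁻ (suc m) = φ m

-- Lets every (-q^(m+1);q)_r be traded for a quotient of products that start at -q.
negPoch-+ : ∀ m r → negPoch 1 (m + r) ≋ negPoch 1 m *ₚ negPoch (suc m) r
negPoch-+ m zero rewrite ℕ.+-identityʳ m =
  solve 1 (λ x → x := x :* con (+ 1)) ≋-refl (negPoch 1 m)
negPoch-+ m (suc r) rewrite ℕ.+-suc m r = ≋-trans
  (*ₚ-cong (negPoch-+ m r) (+ₚ-cong ≋-refl (scale-cong _ last)))
  (*ₚ-assoc (negPoch 1 m) (negPoch (suc m) r) _)
  where
  last : negₚ (qpow 1) *ₚ qpow (m + r) ≋ negₚ (qpow (suc m)) *ₚ qpow r
  last = ≋-trans (*ₚ-congˡ (negₚ (qpow 1)) (qpow-+ m r))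
    (≋-trans (solve 3 (λ x y z → (:- x) :* (y :* z) := (:- (x :* y)) :* z) ≋-refl (qpow 1) (qpow m) (qpow r))
      (*ₚ-cong (scale-cong _ (≋-sym (qpow-+ 1 m))) ≋-refl))

unitConst-φ : ∀ m → UnitConst (φ m)
unitConst-φ m = trans (coeff-+ oneₚ (negₚ (qpow 1 *ₚ qpow m)) 0)
  (cong (λ t → + 1 ℤ.+ t) (trans (coeff-neg (qpow 1 *ₚ qpow m) 0) (cong ℤ.-_ (coeff₀-* (qpow 1) (qpow m)))))

unitConst-ψ : ∀ m → UnitConst (ψ m)
unitConst-ψ m = trans (coeff-+ oneₚ (negₚ (negₚ (qpow 1) *ₚ qpow m)) 0)
  (cong (λ t → + 1 ℤ.+ t) (trans (coeff-neg (negₚ (qpow 1) *ₚ qpow m) 0) (cong ℤ.-_ (coeff₀-* (negₚ (qpow 1)) (qpow m)))))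

unitConst-qfac : ∀ m → UnitConst (qfac m)
unitConst-qfac zero    = refl
unitConst-qfac (suc m) = UnitConst-* (qfac m) (φ m) (unitConst-qfac m) (unitConst-φ m)

unitConst-negPoch : ∀ m → UnitConst (negPoch 1 m)
unitConst-negPoch zero    = refl
unitConst-negPoch (suc m) = UnitConst-* (negPoch 1 m) (ψ m) (unitConst-negPoch m) (unitConst-ψ m)

qbinom-≤ : ∀ s b → qbinom (s + b) s ≡ (qfac (s + b) , qfac s *ₚ qfac b)
qbinom-≤ s b with s ≤? s + b
... | yes _  = cong (λ t → qfac (s + b) , qfac s *ₚ qfac t) (ℕ.m+n∸m≡n s b)
... | no s≰s+b = contradiction (ℕ.m≤m+n s b) s≰s+b

qbinom-> : ∀ {a b} → a < b → qbinom a b ≡ 0ᵣ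
qbinom-> {a} {b} a<b with b ≤? a
... | yes b≤a = contradiction b≤a (ℕ.<⇒≱ a<b)
... | no _    = refl

c-≤ : ∀ s k → c (s + k) k ≡
  fromPoly (qpow (2 ℕ.* (s C 2))) *ᵣ (negPoch k s , negPoch 1 s) *ᵣ qbinom k s
c-≤ s k with k ≤? s + k
... | yes _ rewrite ℕ.m+n∸n≡m s k = refl
... | no k≰s+k = contradiction (ℕ.m≤n+m k s) k≰s+k

c-> : ∀ {n j} → n < j → c n j ≡ 0ᵣ
c-> {n} {j} n<j with j ≤? n
... | yes j≤n = contradiction j≤n (ℕ.<⇒≱ n<j)
... | no _    = refl

∼c⇒∼0 : ∀ {s k x} → k < s → x ∼ c (s + k) k → x ∼ 0ᵣ
∼c⇒∼0 {s} {k} {x} k<s h rewrite c-≤ s k | qbinom-> k<s = ∼-trans _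
  (UnitConst-* (oneₚ *ₚ negPoch 1 s) oneₚ (UnitConst-* oneₚ (negPoch 1 s) refl (unitConst-negPoch s)) refl)
  h (⇒∼0 (*ₚ-zeroʳ (qpow (2 ℕ.* (s C 2)) *ₚ negPoch k s)))

c-diagonal : ∀ k → c k k ∼ 1ᵣ
c-diagonal k rewrite c-≤ 0 k | qbinom-≤ 0 k = cross
  (solve 1 (λ x → con (+ 1) :* con (+ 1) :* x :* con (+ 1) := con (+ 1) :* (con (+ 1) :* con (+ 1) :* (con (+ 1) :* x)))
    ≋-refl (qfac k))

-- Multiplying by (-q;q)_m completes (-q^(m+1);q)_s to (-q;q)_(m+s). The equation `e` records that s
-- does not exceed the column index, so the q-binomial is a genuine quotient.
c-closed : ∀ s m b → suc m ≡ s + b → c (s + suc m) (suc m) ∼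
  ( qpow (2 ℕ.* (s C 2)) *ₚ negPoch 1 (m + s) *ₚ qfac (s + b)
  , negPoch 1 m *ₚ (qfac s *ₚ negPoch 1 s) *ₚ qfac b)
c-closed s m b e rewrite c-≤ s (suc m) | cong (λ t → qbinom t s) e | qbinom-≤ s b = cross
  (≋-trans
    (solve 7 (λ E p f gm fs gs fb → E :* p :* f :* (gm :* (fs :* gs) :* fb) :=
        (gm :* p) :* (E :* f :* fs :* gs :* fb)) ≋-refl
      E (negPoch (suc m) s) (qfac (s + b)) (negPoch 1 m) (qfac s) (negPoch 1 s) (qfac b))
  (≋-trans (*ₚ-cong (≋-sym (negPoch-+ m s)) ≋-refl)
    (solve 6 (λ E g f fs gs fb → g :* (E :* f :* fs :* gs :* fb) :=
        (E :* g :* f) :* (con (+ 1) :* gs :* (fs :* fb))) ≋-refl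
      E (negPoch 1 (m + s)) (qfac (s + b)) (qfac s) (negPoch 1 s) (qfac b))))
  where
  E : Poly
  E = qpow (2 ℕ.* (s C 2))

-- The matrix of W(k,s,a+1), with entries known up to `∼`. Column zero lags by s behind column one,
-- whose index equals that of row zero; this puts the diagonal value of `c` just right of the
-- corner.
record IsHessenberg (s k : ℕ) {a : ℕ} (M : Matrix (suc a)) : Set where
  field
    column₀ : ∀ i → M i zero ∼ c (toℕ i + (s + k)) k
    columns : ∀ i j → M i (suc j) ∼ c (toℕ i + (s + k)) (toℕ j + (s + k))
open IsHessenberg

-- The old column one, of index s+k, becomes column zero and has its successor right beside it, so
-- the lag drops to 1.
minor₀ : ∀ {s k a} {M : Matrix (suc (suc a))} → IsHessenberg s k M → IsHessenberg 1 (s + k) (minor zero M)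
minor₀ {s} {k} {M = M} H = record
  { column₀ = λ i → subst (λ t → M (suc i) (suc zero) ∼ c t (s + k)) (sym (ℕ.+-suc (toℕ i) (s + k)))
      (columns H (suc i) zero)
  ; columns = λ i j → subst (λ t → M (suc i) (suc (suc j)) ∼ c t (toℕ j + suc (s + k)))
      (sym (ℕ.+-suc (toℕ i) (s + k)))
      (subst (λ t → M (suc i) (suc (suc j)) ∼ c (suc (toℕ i + (s + k))) t)
        (sym (ℕ.+-suc (toℕ j) (s + k))) (columns H (suc i) (suc j)))
  }

-- Column zero survives while its neighbour is deleted, so the lag grows by one.
minor₁ : ∀ {s k a} {M : Matrix (suc (suc a))} → IsHessenberg s k M → IsHessenberg (suc s) k (minor (suc zero) M)
minor₁ {s} {k} {M = M} H = record
  { column₀ = λ i → subst (λ t → M (suc i) zero ∼ c t k) (sym (ℕ.+-suc (toℕ i) (s + k)))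
      (column₀ H (suc i))
  ; columns = columns (minor₀ H)
  }

row₀-vanishing : ∀ {s k a} {M : Matrix (suc (suc a))} → IsHessenberg s k M → ∀ t → M zero (suc (suc t)) ∼ 0ᵣ
row₀-vanishing {s} {k} {M = M} H t = subst (M zero (suc (suc t)) ∼_)
  (c-> (ℕ.s≤s (ℕ.m≤n+m (s + k) (toℕ t)))) (columns H zero (suc t))

-- For s > k the corner vanishes with its q-binomial. The second minor has an even larger lag, so it
-- vanishes by induction.
hessenberg-zero : ∀ a {s k} {M : Matrix (suc a)} → k < s → IsHessenberg s k M → det (suc a) M ∼ 0ᵣ
hessenberg-zero zero    {M = M} k<s H = det₁ M (∼c⇒∼0 k<s (column₀ H zero))
hessenberg-zero (suc a) {M = M} k<s H = det-zero-column a M (row₀-vanishing H)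
  (∼c⇒∼0 k<s (column₀ H zero)) (hessenberg-zero a (ℕ.m≤n⇒m≤1+n k<s) (minor₁ H))

-- The closed form of the determinants

qTri : ℕ → Poly
qTri r = qpow (2 ℕ.* (suc r C 2))

-- The closed form of W(s+b,s,a+1) for s = r+1: with k = s+b and n = s+a the
-- arguments are m = k-1, i = 2n+k-s-2, g = n+k-1, l = n-1.  They are separate so
-- that each use can choose a convenient normal form of the index.
closedForm : (r a b m i g l : ℕ) → RatFun
closedForm r a b m i g l =
  ( qTri r *ₚ qfac (suc (suc i)) *ₚ qfac (suc m) *ₚ negPoch 1 g
  , negPoch 1 m *ₚ qfac (suc g) *ₚ κ l *ₚ (qfac r *ₚ negPoch 1 r) *ₚ (qfac a *ₚ negPoch 1 a) *ₚ qfac b )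

closedForm-cong : ∀ r a b {m m′ i i′ g g′ l l′} → m ≡ m′ → i ≡ i′ → g ≡ g′ → l ≡ l′ →
  closedForm r a b m i g l ≡ closedForm r a b m′ i′ g′ l′
closedForm-cong r a b refl refl refl refl = refl

unitConst-closedForm : ∀ r a b m i g l → UnitConst (proj₂ (closedForm r a b m i g l))
unitConst-closedForm r a b m i g l =
  UnitConst-* (G m *ₚ qfac (suc g) *ₚ κ l *ₚ (qfac r *ₚ G r) *ₚ (qfac a *ₚ G a)) (qfac b)
  (UnitConst-* (G m *ₚ qfac (suc g) *ₚ κ l *ₚ (qfac r *ₚ G r)) (qfac a *ₚ G a)
  (UnitConst-* (G m *ₚ qfac (suc g) *ₚ κ l) (qfac r *ₚ G r)
  (UnitConst-* (G m *ₚ qfac (suc g)) (κ l)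
  (UnitConst-* (G m) (qfac (suc g)) (unitConst-negPoch m) (unitConst-qfac (suc g)))
  (UnitConst-* (φ l) (ψ l) (unitConst-φ l) (unitConst-ψ l)))
  (UnitConst-* (qfac r) (G r) (unitConst-qfac r) (unitConst-negPoch r)))
  (UnitConst-* (qfac a) (G a) (unitConst-qfac a) (unitConst-negPoch a)))
  (unitConst-qfac b)
  where
  G : ℕ → Poly
  G = negPoch 1

hessenbergDet : ℕ → ℕ → ℕ → RatFun
hessenbergDet r a b = closedForm r a b (r + b) (r + a + (r + a) + b) (r + a + suc (r + b)) (r + a)

entry : (r b m : ℕ) → RatFun
entry r b m =
  ( qTri r *ₚ negPoch 1 (suc (m + r)) *ₚ qfac (suc m)
  , negPoch 1 m *ₚ (qfac (suc r) *ₚ negPoch 1 (suc r)) *ₚ qfac b )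

unitConst-entry : ∀ r b m → UnitConst (proj₂ (entry r b m))
unitConst-entry r b m =
  UnitConst-* (negPoch 1 m *ₚ (qfac (suc r) *ₚ negPoch 1 (suc r))) (qfac b)
  (UnitConst-* (negPoch 1 m) (qfac (suc r) *ₚ negPoch 1 (suc r)) (unitConst-negPoch m)
    (UnitConst-* (qfac (suc r)) (negPoch 1 (suc r)) (unitConst-qfac (suc r)) (unitConst-negPoch (suc r))))
  (unitConst-qfac b)

-- The base case a = 0. Here n = s, so `qfac` of i+2 and of g+1 coincide and cancel, while `κ r`
-- supplies the last factors of `qfac (suc r)` and `negPoch 1 (suc r)`.
entry∼closedForm : ∀ r b m → entry r b m ∼ closedForm r 0 b m (m + r) (suc (m + r)) r
entry∼closedForm r b m = cross
  (solve 10 (λ E G fk gm fg φr ψr fr gr fb →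
      E :* G :* fk :* (gm :* fg :* (φr :* ψr) :* (fr :* gr) :* (con (+ 1) :* con (+ 1)) :* fb) :=
      E :* fg :* fk :* G :* (gm :* ((fr :* φr) :* (gr :* ψr)) :* fb)) ≋-refl
    (qTri r) (negPoch 1 (suc (m + r))) (qfac (suc m)) (negPoch 1 m) (qfac (suc (suc (m + r)))) (φ r) (ψ r)
    (qfac r) (negPoch 1 r) (qfac b))

c∼entry : ∀ r b → c (suc r + suc (r + b)) (suc (r + b)) ∼ entry r b (r + b)
c∼entry r b = subst (λ t → c (suc r + suc (r + b)) (suc (r + b)) ∼
    ( qTri r *ₚ negPoch 1 t *ₚ qfac (suc (r + b))
    , negPoch 1 (r + b) *ₚ (qfac (suc r) *ₚ negPoch 1 (suc r)) *ₚ qfac b ))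
  (ℕ.+-suc (r + b) r) (c-closed (suc r) (r + b) b refl)

-- The identity of q-powers and the induction step

φ≋ : ∀ m → φ m ≋ oneₚ -ₚ qpow (suc m)
φ≋ m = +ₚ-cong ≋-refl (scale-cong _ (≋-sym (qpow-+ 1 m)))

ψ≋ : ∀ m → ψ m ≋ oneₚ +ₚ qpow (suc m)
ψ≋ m = ≋-trans (solve 2 (λ x y → con (+ 1) :- (:- x) :* y := con (+ 1) :+ x :* y) ≋-refl (qpow 1) (qpow m))
  (+ₚ-cong {oneₚ} ≋-refl (≋-sym (qpow-+ 1 m)))

κ≋ : ∀ m → κ m ≋ oneₚ -ₚ qpow (suc m) *ₚ qpow (suc m)
κ≋ m = ≋-trans (*ₚ-cong (φ≋ m) (ψ≋ m))
  (solve 1 (λ x → (con (+ 1) :- x) :* (con (+ 1) :+ x) := con (+ 1) :- x :* x) ≋-refl (qpow (suc m)))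

φ⁻≋ : ∀ b → φ⁻ b ≋ oneₚ -ₚ qpow b
φ⁻≋ zero    = ≋-sym (∷-zero ≋-refl)
φ⁻≋ (suc b) = φ≋ b

qTri-suc : ∀ r → qTri (suc r) ≋ qTri r *ₚ (qpow (suc r) *ₚ qpow (suc r))
qTri-suc r = ≋-trans (≡⇒≋ (cong qpow exponent)) (≋-trans (qpow-+ (2 ℕ.* (suc r C 2)) (suc r + suc r))
  (*ₚ-congˡ (qTri r) (qpow-+ (suc r) (suc r))))
  where
  exponent : 2 ℕ.* (suc (suc r) C 2) ≡ 2 ℕ.* (suc r C 2) + (suc r + suc r)
  exponent = trans (cong (2 ℕ.*_) (trans (sym (nCk+nC[k+1]≡[n+1]C[k+1] (suc r) 1)) (cong (_+ suc r C 2) (nC1≡n (suc r)))))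
    (N.solve 2 (λ s t → N.con 2 N.:* (s N.:+ t) N.:= N.con 2 N.:* t N.:+ (s N.:+ s)) refl (suc r) (suc r C 2))

-- With A = q^(2r+2), B = q^(2a+2), C = q^b this is
-- (1 - A B C) (1 - A) = (1 - A C) (1 - A B) - A (1 - B) (1 - C).
three-term : ∀ r a b → φ (suc (suc (a + a + (r + suc (r + b))))) *ₚ κ r ≋
  φ (r + suc (r + b)) *ₚ κ (r + suc a) -ₚ qpow (suc r) *ₚ qpow (suc r) *ₚ κ a *ₚ φ⁻ b
three-term r a b = ≋-trans
  (*ₚ-cong (≋-trans (φ≋ (suc (suc (a + a + (r + suc (r + b)))))) (1- split₁)) (κ≋ r))
  (≋-trans (solve 3 (λ x y z → (con (+ 1) :- x :* x :* (y :* y) :* z) :* (con (+ 1) :- x :* x) :=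
        (con (+ 1) :- x :* x :* z) :* (con (+ 1) :- (x :* y) :* (x :* y))
          :- x :* x :* (con (+ 1) :- y :* y) :* (con (+ 1) :- z)) ≋-refl x y z)
    (≋-sym (+ₚ-cong
      (*ₚ-cong (≋-trans (φ≋ (r + suc (r + b))) (1- split₂)) (≋-trans (κ≋ (r + suc a)) (1- (*ₚ-cong split₃ split₃))))
      (scale-cong _ (*ₚ-cong (*ₚ-congˡ (x *ₚ x) (κ≋ a)) (φ⁻≋ b))))))
  where
  x y z : Poly
  x = qpow (suc r)
  y = qpow (suc a)
  z = qpow b
  1-_ : ∀ {p p′} → p ≋ p′ → oneₚ -ₚ p ≋ oneₚ -ₚ p′
  1- h = +ₚ-cong ≋-refl (scale-cong _ h)
  split₁ : qpow (suc (suc (suc (a + a + (r + suc (r + b)))))) ≋ x *ₚ x *ₚ (y *ₚ y) *ₚ z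
  split₁ = ≋-trans (≡⇒≋ (cong qpow (N.solve 3 (λ r a b →
      N.con 3 N.:+ (a N.:+ a N.:+ (r N.:+ (N.con 1 N.:+ (r N.:+ b)))) N.:=
      N.con 1 N.:+ r N.:+ (N.con 1 N.:+ r) N.:+ (N.con 1 N.:+ a N.:+ (N.con 1 N.:+ a)) N.:+ b) refl r a b)))
    (≋-trans (qpow-+ (suc r + suc r + (suc a + suc a)) b) (*ₚ-cong
      (≋-trans (qpow-+ (suc r + suc r) (suc a + suc a))
        (*ₚ-cong (qpow-+ (suc r) (suc r)) (qpow-+ (suc a) (suc a)))) ≋-refl))
  split₂ : qpow (suc (r + suc (r + b))) ≋ x *ₚ x *ₚ z
  split₂ = ≋-trans (≡⇒≋ (cong qpow (sym (ℕ.+-assoc (suc r) (suc r) b))))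
    (≋-trans (qpow-+ (suc r + suc r) b) (*ₚ-cong (qpow-+ (suc r) (suc r)) ≋-refl))
  split₃ : qpow (suc (r + suc a)) ≋ x *ₚ y
  split₃ = qpow-+ (suc r) (suc a)

-- The closed form of W(k,s+1,a+1), extended by the factor φ⁻ b to the case k = s,
-- where this determinant vanishes.
shifted : (r a b m i g l : ℕ) → RatFun
shifted r a b m i g l =
  ( qTri (suc r) *ₚ qfac (suc (suc i)) *ₚ qfac (suc m) *ₚ negPoch 1 g *ₚ κ a *ₚ φ⁻ b
  , negPoch 1 m *ₚ qfac (suc g) *ₚ κ l *ₚ (qfac (suc r) *ₚ negPoch 1 (suc r))
      *ₚ (qfac (suc a) *ₚ negPoch 1 (suc a)) *ₚ qfac b )

-- When k > s, the extra factors `κ a` and `φ⁻ (suc b)` cancel the last factors of the products at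
-- a+1 and of `qfac (suc b)`.
closedForm∼shifted : ∀ r a b m i g l → closedForm (suc r) a b m i g l ∼ shifted r a (suc b) m i g l
closedForm∼shifted r a b m i g l = cross
  (solve 15 (λ E f fk G gm fg κl fs gs fa ga φa ψa fb φb →
      E :* f :* fk :* G :* (gm :* fg :* κl :* (fs :* gs) :* ((fa :* φa) :* (ga :* ψa)) :* (fb :* φb)) :=
      E :* f :* fk :* G :* (φa :* ψa) :* φb :* (gm :* fg :* κl :* (fs :* gs) :* (fa :* ga) :* fb)) ≋-refl
    (qTri (suc r)) (qfac (suc (suc i))) (qfac (suc m)) (negPoch 1 g) (negPoch 1 m) (qfac (suc g)) (κ l)
    (qfac (suc r)) (negPoch 1 (suc r)) (qfac a) (negPoch 1 a) (φ a) (ψ a) (qfac b) (φ b))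

-- The Hessenberg recursion for the closed forms. All three determinants have the same n+k-1, hence
-- one `g`; the two minors also share `i`. With common parts Y and Z the recursion reads pY/Z -
-- qY/(Z κ l), and `identity` evaluates p κ l - q.
module Step (r a b m i g l : ℕ)
  (identity : φ (suc (suc i)) *ₚ κ r ≋ φ (suc (m + r)) *ₚ κ l -ₚ qpow (suc r) *ₚ qpow (suc r) *ₚ κ a *ₚ φ⁻ b) where

  private
    Y Z p q : Poly
    Y = qTri r *ₚ qfac (suc m) *ₚ qfac (suc (suc i)) *ₚ negPoch 1 g
    Z = negPoch 1 m *ₚ qfac (suc g) *ₚ (qfac (suc r) *ₚ negPoch 1 (suc r))
          *ₚ (qfac (suc a) *ₚ negPoch 1 (suc a)) *ₚ qfac b
    p = φ (suc (m + r))
    q = qpow (suc r) *ₚ qpow (suc r) *ₚ κ a *ₚ φ⁻ b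

    unitConst-Z : UnitConst Z
    unitConst-Z =
      UnitConst-* (negPoch 1 m *ₚ qfac (suc g) *ₚ (qfac (suc r) *ₚ negPoch 1 (suc r)) *ₚ (qfac (suc a) *ₚ negPoch 1 (suc a))) (qfac b)
      (UnitConst-* (negPoch 1 m *ₚ qfac (suc g) *ₚ (qfac (suc r) *ₚ negPoch 1 (suc r))) (qfac (suc a) *ₚ negPoch 1 (suc a))
      (UnitConst-* (negPoch 1 m *ₚ qfac (suc g)) (qfac (suc r) *ₚ negPoch 1 (suc r))
      (UnitConst-* (negPoch 1 m) (qfac (suc g)) (unitConst-negPoch m) (unitConst-qfac (suc g)))
      (UnitConst-* (qfac (suc r)) (negPoch 1 (suc r)) (unitConst-qfac (suc r)) (unitConst-negPoch (suc r))))
      (UnitConst-* (qfac (suc a)) (negPoch 1 (suc a)) (unitConst-qfac (suc a)) (unitConst-negPoch (suc a))))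
      (unitConst-qfac b)

    unitConst-Zκ : UnitConst (Z *ₚ κ l)
    unitConst-Zκ = UnitConst-* Z (κ l) unitConst-Z (UnitConst-* (φ l) (ψ l) (unitConst-φ l) (unitConst-ψ l))

    -- `negPoch 1 (suc (m + r))` and `qfac (suc (m + r))` cancel across the product; the last factor
    -- `p` of `qfac (suc (suc (m + r)))` is left over.
    first : entry r b m *ᵣ closedForm 0 a (suc (m + r)) (suc (m + r)) i g a ∼ (p *ₚ Y , Z)
    first = cross (solve 16 (λ E G₁ fk f fb′ φb′ G gm fs gs fb fg fa ga φa ψa →
        E :* G₁ :* fk :* (con (+ 1) :* f :* (fb′ :* φb′) :* G) :*
          (gm :* fg :* (fs :* gs) :* ((fa :* φa) :* (ga :* ψa)) :* fb) :=
        φb′ :* (E :* fk :* f :* G) :*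
          (gm :* (fs :* gs) :* fb :* (G₁ :* fg :* (φa :* ψa) :* (con (+ 1) :* con (+ 1)) :* (fa :* ga) :* fb′))) ≋-refl
      (qTri r) (negPoch 1 (suc (m + r))) (qfac (suc m)) (qfac (suc (suc i))) (qfac (suc (m + r))) p (negPoch 1 g)
      (negPoch 1 m) (qfac (suc r)) (negPoch 1 (suc r)) (qfac b) (qfac (suc g)) (qfac a) (negPoch 1 a) (φ a) (ψ a))

    second : shifted r a b m i g l ∼ (q *ₚ Y , Z *ₚ κ l)
    second = ∼-respˡ
      (*ₚ-cong (*ₚ-cong (*ₚ-cong (*ₚ-cong (*ₚ-cong (qTri-suc r) (≋-refl {qfac (suc (suc i))})) (≋-refl {qfac (suc m)}))
        (≋-refl {negPoch 1 g})) (≋-refl {κ a})) (≋-refl {φ⁻ b}))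
      (cross (solve 13 (λ E X f fk G κa φb gm fg Fs fb κl Fa →
        E :* X :* f :* fk :* G :* κa :* φb :* (gm :* fg :* Fs :* Fa :* fb :* κl) :=
        X :* κa :* φb :* (E :* fk :* f :* G) :* (gm :* fg :* κl :* Fs :* Fa :* fb)) ≋-refl
      (qTri r) (qpow (suc r) *ₚ qpow (suc r)) (qfac (suc (suc i))) (qfac (suc m)) (negPoch 1 g) (κ a) (φ⁻ b)
      (negPoch 1 m) (qfac (suc g)) (qfac (suc r) *ₚ negPoch 1 (suc r))
      (qfac b) (κ l) (qfac (suc a) *ₚ negPoch 1 (suc a))))

    difference : (p *ₚ Y , Z) +ᵣ negᵣ (q *ₚ Y , Z *ₚ κ l) ∼ ((p *ₚ κ l -ₚ q) *ₚ Y , Z *ₚ κ l)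
    difference = cross (solve 5 (λ p q y z k →
      (p :* y :* (z :* k) :+ (:- (q :* y)) :* z) :* (z :* k) := (p :* k :- q) :* y :* (z :* (z :* k)))
      ≋-refl p q Y Z (κ l))

    -- Of the factors supplied by `identity`, `φ (suc (suc i))` extends the q-factorial to the index
    -- for `suc i`, and `κ r` lowers the denominator's products from r+1 to r.
    total : ((p *ₚ κ l -ₚ q) *ₚ Y , Z *ₚ κ l) ∼ closedForm r (suc a) b m (suc i) g l
    total = ∼-respˡ (*ₚ-cong (≋-sym identity) (≋-refl {Y}))
      (cross (solve 14 (λ E fk f G gm fg fr gr Fa fb κl φr ψr φi →
        φi :* (φr :* ψr) :* (E :* fk :* f :* G) :* (gm :* fg :* κl :* (fr :* gr) :* Fa :* fb) :=
        E :* (f :* φi) :* fk :* G :* (gm :* fg :* ((fr :* φr) :* (gr :* ψr)) :* Fa :* fb :* κl)) ≋-refl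
      (qTri r) (qfac (suc m)) (qfac (suc (suc i))) (negPoch 1 g) (negPoch 1 m) (qfac (suc g)) (qfac r) (negPoch 1 r)
      (qfac (suc a) *ₚ negPoch 1 (suc a)) (qfac b) (κ l) (φ r) (ψ r) (φ (suc (suc i)))))

  step : entry r b m *ᵣ closedForm 0 a (suc (m + r)) (suc (m + r)) i g a +ᵣ negᵣ (shifted r a b m i g l)
    ∼ closedForm r (suc a) b m (suc i) g l
  step = ∼-trans ((p *ₚ Y , Z) +ᵣ negᵣ (q *ₚ Y , Z *ₚ κ l)) (UnitConst-* Z (Z *ₚ κ l) unitConst-Z unitConst-Zκ)
    (+ᵣ-cong first (negᵣ-cong second))
    (∼-trans ((p *ₚ κ l -ₚ q) *ₚ Y , Z *ₚ κ l) unitConst-Zκ difference total)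

open Step using (step)

-- The induction on the size

unitConst-c : ∀ s b → UnitConst (proj₂ (c (s + (s + b)) (s + b)))
unitConst-c s b rewrite c-≤ s (s + b) | qbinom-≤ s b =
  UnitConst-* (oneₚ *ₚ negPoch 1 s) (qfac s *ₚ qfac b)
    (UnitConst-* oneₚ (negPoch 1 s) refl (unitConst-negPoch s))
    (UnitConst-* (qfac s) (qfac b) (unitConst-qfac s) (unitConst-qfac b))

-- Induction on a with r and b general, since the two minors change s and k. Writing s = r+1 and k =
-- s+b encodes 1 ≤ s ≤ k.
hessenberg : ∀ a r b {M : Matrix (suc a)} → IsHessenberg (suc r) (suc (r + b)) M → det (suc a) M ∼ hessenbergDet r a b
hessenberg zero r b {M} H = subst (det 1 M ∼_)
  (sym (closedForm-cong r 0 b (refl {x = r + b})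
    (N.solve 2 (λ r b → r N.:+ N.con 0 N.:+ (r N.:+ N.con 0) N.:+ b N.:= r N.:+ b N.:+ r) refl r b)
    (N.solve 2 (λ r b → r N.:+ N.con 0 N.:+ (N.con 1 N.:+ (r N.:+ b)) N.:= N.con 1 N.:+ (r N.:+ b N.:+ r)) refl r b)
    (ℕ.+-identityʳ r)))
  (det₁ M (∼-trans (entry r b (r + b)) (unitConst-entry r b (r + b))
    (∼-trans (c (suc r + suc (r + b)) (suc (r + b))) (unitConst-c (suc r) b) (column₀ H zero) (c∼entry r b))
    (entry∼closedForm r b (r + b))))
hessenberg (suc a) r b {M} H = subst (det (suc (suc a)) M ∼_)
  (sym (closedForm-cong r (suc a) b (refl {x = m})
    (N.solve 3 (λ r a b → r N.:+ (N.con 1 N.:+ a) N.:+ (r N.:+ (N.con 1 N.:+ a)) N.:+ b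
        N.:= N.con 1 N.:+ (a N.:+ a N.:+ (r N.:+ (N.con 1 N.:+ (r N.:+ b))))) refl r a b)
    g-eq (refl {x = l})))
  (∼-trans (entry r b m *ᵣ h +ᵣ negᵣ w) unitConst-entry-h-w
    (det-two-terms a M (row₀-vanishing H)
      (∼-trans (c (suc r + suc m) (suc m)) (unitConst-c (suc r) b) (column₀ H zero) (c∼entry r b))
      (∼-trans (c (suc r + suc m) (suc r + suc m)) (unitConst-c 0 (suc r + suc m)) (columns H zero zero) (c-diagonal _))
      D₀ (D₁ b H))
    (step r a b m i g l (subst (λ t → φ (suc (suc i)) *ₚ κ r ≋ φ t *ₚ κ l -ₚ qpow (suc r) *ₚ qpow (suc r) *ₚ κ a *ₚ φ⁻ b)
      b′-eq (three-term r a b))))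
  where
  m i g l : ℕ
  m = r + b
  i = a + a + (r + suc (r + b))
  g = a + suc (r + suc (r + b))
  l = r + suc a
  h w : RatFun
  h = closedForm 0 a (suc (m + r)) (suc (m + r)) i g a
  w = shifted r a b m i g l
  g-eq : r + suc a + suc (r + b) ≡ g
  g-eq = N.solve 3 (λ r a b → r N.:+ (N.con 1 N.:+ a) N.:+ (N.con 1 N.:+ (r N.:+ b))
    N.:= a N.:+ (N.con 1 N.:+ (r N.:+ (N.con 1 N.:+ (r N.:+ b))))) refl r a b
  b′-eq : r + suc (r + b) ≡ suc (m + r)
  b′-eq = trans (ℕ.+-suc r m) (cong suc (ℕ.+-comm r m))
  unitConst-entry-h-w : UnitConst (proj₂ (entry r b m *ᵣ h +ᵣ negᵣ w))
  unitConst-entry-h-w = UnitConst-* (proj₂ (entry r b m) *ₚ proj₂ h) (proj₂ w)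
    (UnitConst-* (proj₂ (entry r b m)) (proj₂ h) (unitConst-entry r b m)
      (unitConst-closedForm 0 a (suc (m + r)) (suc (m + r)) i g a))
    (unitConst-closedForm (suc r) (suc a) b m i g l)
  -- The new lag 1 means r = 0, and the new k is k+s, so the new b is k+s-1 = `r + suc (r + b)`.
  D₀ : det (suc a) (minor zero M) ∼ h
  D₀ = subst (det (suc a) (minor zero M) ∼_) (cong (λ t → closedForm 0 a t t i g a) b′-eq)
    (hessenberg a 0 (r + suc (r + b)) (minor₀ H))
  -- Split on b = k - s. If b = 0, the lag s+1 exceeds k and both sides vanish, the right one
  -- through `φ⁻ zero`. Otherwise the induction hypothesis applies with b lowered by one.
  D₁ : ∀ b → IsHessenberg (suc r) (suc (r + b)) M → det (suc a) (minor (suc zero) M) ∼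
    shifted r a b (r + b) (a + a + (r + suc (r + b))) (a + suc (r + suc (r + b))) l
  D₁ zero    H = ∼-trans 0ᵣ refl (hessenberg-zero a (s≤s (s≤s (ℕ.≤-reflexive (ℕ.+-identityʳ r)))) (minor₁ H))
    (∼-sym (⇒∼0 (*ₚ-zeroʳ (qTri (suc r) *ₚ qfac (suc (suc (a + a + (r + suc (r + zero)))))
      *ₚ qfac (suc (r + zero)) *ₚ negPoch 1 (a + suc (r + suc (r + zero))) *ₚ κ a))))
  D₁ (suc b) H = ∼-trans
    (closedForm (suc r) a b (r + suc b) (a + a + (r + suc (r + suc b))) (a + suc (r + suc (r + suc b))) l)
    (unitConst-closedForm (suc r) a b (r + suc b) (a + a + (r + suc (r + suc b))) (a + suc (r + suc (r + suc b))) l)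
    (subst (det (suc a) (minor (suc zero) M) ∼_)
      (closedForm-cong (suc r) a b (sym (ℕ.+-suc r b))
        (N.solve 3 (λ r a b → N.con 1 N.:+ r N.:+ a N.:+ (N.con 1 N.:+ r N.:+ a) N.:+ b N.:=
          a N.:+ a N.:+ (r N.:+ (N.con 1 N.:+ (r N.:+ (N.con 1 N.:+ b))))) refl r a b)
        (N.solve 3 (λ r a b → N.con 1 N.:+ r N.:+ a N.:+ (N.con 1 N.:+ (N.con 1 N.:+ r N.:+ b)) N.:=
          a N.:+ (N.con 1 N.:+ (r N.:+ (N.con 1 N.:+ (r N.:+ (N.con 1 N.:+ b)))))) refl r a b)
        (sym (ℕ.+-suc r a)))
      (hessenberg a (suc r) b (subst (λ t → IsHessenberg (suc (suc r)) t (minor (suc zero) M))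
        (cong suc (ℕ.+-suc r b)) (minor₁ H))))
    (closedForm∼shifted r a b (r + suc b) (a + a + (r + suc (r + suc b))) (a + suc (r + suc (r + suc b))) l)

-- Comparison with the right-hand side

rhs-zero : ∀ b → 1ᵣ ∼ rhs (suc b) 0
rhs-zero b rewrite qbinom-≤ 0 (suc b) = cross
  (solve 4 (λ K q₁ f g → con (+ 1) :* ((q₁ :* K) :* (con (+ 1) :* f) :* g) := (K :* q₁) :* f :* g :* con (+ 1)) ≋-refl
    (oneₚ -ₚ qpow (suc b)) (oneₚ -ₚ qpow 1) (qfac (suc b)) (negPoch 1 b))

-- Here n = a+1, k = b+1 and t = 2n+k-1. The factor 1-q^k comes from `qfac (suc b)`, 1-q^(2n+k)
-- cancels the last factor of `qfac (suc t)`, and (-q;q)_(n+k-1) splits after n factors.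
hessenbergDet∼rhs : ∀ a b → hessenbergDet 0 a b ∼ rhs (suc b) (suc a)
hessenbergDet∼rhs a b = subst (hessenbergDet 0 a b ∼_) (sym rhs-simplified) (cross
  (≋-trans
    (solve 10 (λ f fb φb G Kt fa φa fN gb q₁ →
        con (+ 1) :* f :* (fb :* φb) :* G :* ((q₁ :* Kt) :* ((fa :* φa) :* fN) :* gb) :=
        (φb :* (Kt :* G)) :* (f :* fb :* q₁ :* fa :* φa :* fN :* gb)) ≋-refl
      (qfac t) (qfac b) (φ b) (negPoch 1 (a + suc b)) (oneₚ -ₚ qpow (suc t)) (qfac a) (φ a) (qfac (suc (a + suc b)))
      (negPoch 1 b) (oneₚ -ₚ qpow 1))
  (≋-trans (*ₚ-cong (*ₚ-cong (φ≋ b) (*ₚ-cong (≋-sym (φ≋ t)) negPoch-split)) ≋-refl)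
    (solve 12 (λ f fb K fa φa fN gb q₁ ψa ga φt P →
        (K :* (φt :* (ga :* ψa :* P))) :* (f :* fb :* q₁ :* fa :* φa :* fN :* gb) :=
        (K :* q₁) :* (f :* φt) :* P :* (gb :* fN :* (φa :* ψa) :* (con (+ 1) :* con (+ 1)) :* (fa :* ga) :* fb)) ≋-refl
      (qfac t) (qfac b) K (qfac a) (φ a) (qfac (suc (a + suc b)))
      (negPoch 1 b) (oneₚ -ₚ qpow 1) (ψ a) (negPoch 1 a) (φ t) (negPoch (suc (suc a)) b)))))
  where
  t : ℕ
  t = suc (suc (a + a + b))
  K : Poly
  K = oneₚ -ₚ qpow (suc b)
  negPoch-split : negPoch 1 (a + suc b) ≋ negPoch 1 (suc a) *ₚ negPoch (suc (suc a)) b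
  negPoch-split = ≋-trans (≡⇒≋ (cong (negPoch 1) (ℕ.+-suc a b))) (negPoch-+ (suc a) b)
  2n+k : 2 ℕ.* suc a + suc b ≡ suc t
  2n+k = N.solve 2 (λ a b → N.con 2 N.:* (N.con 1 N.:+ a) N.:+ (N.con 1 N.:+ b) N.:= N.con 3 N.:+ (a N.:+ a N.:+ b)) refl a b
  n+[n+k] : suc a + suc (a + suc b) ≡ suc t
  n+[n+k] = N.solve 2 (λ a b → N.con 1 N.:+ a N.:+ (N.con 1 N.:+ (a N.:+ (N.con 1 N.:+ b))) N.:=
    N.con 3 N.:+ (a N.:+ a N.:+ b)) refl a b
  qbinom-split : qbinom (suc t) (suc a) ≡ (qfac (suc t) , qfac (suc a) *ₚ qfac (suc (a + suc b)))
  qbinom-split = subst (λ u → qbinom u (suc a) ≡ (qfac u , qfac (suc a) *ₚ qfac (suc (a + suc b)))) n+[n+k]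
    (qbinom-≤ (suc a) (suc (a + suc b)))
  rhs-simplified : rhs (suc b) (suc a) ≡
    (qint (suc b) /ᵣ qint (suc t)) *ᵣ (qfac (suc t) , qfac (suc a) *ₚ qfac (suc (a + suc b)))
      *ᵣ (negPoch (suc (suc a)) b , negPoch 1 b)
  rhs-simplified = trans
    (cong (λ u → (qint (suc b) /ᵣ qint u) *ᵣ qbinom u (suc a) *ᵣ (negPoch (suc a + 1) b , negPoch 1 b)) 2n+k)
    (cong₂ (λ u v → (qint (suc b) /ᵣ qint (suc t)) *ᵣ u *ᵣ (negPoch v b , negPoch 1 b)) qbinom-split (ℕ.+-comm (suc a) 1))

theorem8 : (k : ℕ) → 1 ≤ k → (n : ℕ) →
    det n (λ i j → c (toℕ i + k + 1) (toℕ j + k)) ≃ rhs k n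
-- The induction starts at size one, so the empty determinant is compared directly.
theorem8 (suc b) (s≤s z≤n) zero = ∼⇒≃ {1ᵣ} {rhs (suc b) zero} (rhs-zero b)
theorem8 (suc b) (s≤s z≤n) (suc a) = ∼⇒≃ {det (suc a) M} {rhs (suc b) (suc a)}
  (∼-trans (hessenbergDet 0 a b) (unitConst-closedForm 0 a b b (a + a + b) (a + suc b) a) (hessenberg a 0 b hess) (hessenbergDet∼rhs a b))
  where
  M : Matrix (suc a)
  M i j = c (toℕ i + suc b + 1) (toℕ j + suc b)
  row : ∀ x → x + suc b + 1 ≡ x + suc (suc b)
  row x = trans (ℕ.+-assoc x (suc b) 1) (cong (λ t → x + t) (ℕ.+-comm (suc b) 1))
  -- In the given matrix consecutive columns have consecutive indices, which is lag 1.
  hess : IsHessenberg 1 (suc b) M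
  hess = record
    { column₀ = λ i → ∼-reflexive (cong (λ t → c t (suc b)) (row (toℕ i)))
    ; columns = λ i j → ∼-reflexive (cong₂ c (row (toℕ i)) (sym (ℕ.+-suc (toℕ j) (suc b))))
    }
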